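{- For every integer $n\ge 1$, $$\mathrm{pf}_n(213,312,321)=C_n+(n-1)(C_n-C_{n-1})=nC_n-(n-1)C_{n-1},$$ where $C_k=\frac{1}{k+1}\binom{2k}{k}$ is the $k$th Catalan number.
   Context: A Dyck path of semilength $n$ is a lattice path from $(0,0)$ to $(n,n)$ consisting of $n$ north steps $N=(0,1)$ and $n$ east steps $E=(1,0)$ that never goes below the line $y=x$. A parking function of size $n$ is a Dyck path of semilength $n$ whose $n$ north steps are labeled bijectively by $\{1,\dots,n\}$ so that whenever two north steps are consecutive in the path (one immediately following the other), the label of the later one is larger. For a parking function $p$ of size $n$, $\phi(p)$ is the permutation of $\{1,\dots,n\}$ (in one-line notation) obtained by reading the labels of the north steps in the order they occur along the path. A permutation $\pi$ of $\{1,\dots,n\}$ contains a permutation $\rho$ of $\{1,\dots,m\}$ if there are indices $1\le i_1<\cdots<i_m\le n$ such that $\pi_{i_a}\le\pi_{i_b}$ if and only if $\rho_a\le\rho_b$; otherwise $\pi$ avoids $\rho$. For permutations $\rho_1,\dots,\rho_r$, $\mathrm{pf}_n(\rho_1,\dots,\rho_r)$ denotes the number of parking functions $p$ of size $n$ such that $\phi(p)$ avoids each of $\rho_1,\dots,\rho_r$. -}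

module Defs where

open import Data.Nat.Base using (ℕ; zero; suc; _*_; _≤_; _<_; _/_)
open import Data.Nat.Combinatorics using (_C_)
open import Data.Fin.Base as Fin using (Fin)
open import Data.List.Base using (List; []; _∷_; _++_; map; length; lookup; applyUpTo)
open import Data.List.Membership.Propositional using (_∈_)
open import Data.List.Relation.Unary.All using (All)
open import Data.List.Relation.Unary.Unique.Propositional using (Unique)
open import Data.List.Relation.Binary.Permutation.Propositional using (_↭_)
open import Data.Product.Base using (Σ-syntax; _×_)
open import Function.Bundles using (_⇔_)
open import Relation.Binary.PropositionalEquality.Core using (_≡_)
open import Relation.Nullary.Negation.Core using (¬_)

data Step : Set where
  N E : Step

#N : List Step → ℕ
#N []      = zero
#N (N ∷ p) = suc (#N p)
#N (E ∷ p) = #N p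

#E : List Step → ℕ
#E []      = zero
#E (N ∷ p) = #E p
#E (E ∷ p) = suc (#E p)

-- The point reached after a prefix u of a path is (#E u , #N u).
record IsDyckPath (n : ℕ) (p : List Step) : Set where
  field
    norths     : #N p ≡ n
    easts      : #E p ≡ n
    neverBelow : ∀ u v → p ≡ u ++ v → #E u ≤ #N u

data LabelledStep : Set where
  north : ℕ → LabelledStep
  east  : LabelledStep

unlabel : LabelledStep → Step
unlabel (north _) = N
unlabel east      = E

φ : List LabelledStep → List ℕ
φ []            = []
φ (north a ∷ w) = a ∷ φ w
φ (east ∷ w)    = φ w

-- Permutations are kept in one-line notation, as rearrangements of 1, 2, …, n.
IsPermutation : ℕ → List ℕ → Set
IsPermutation n π = π ↭ applyUpTo suc n

record IsParkingFunction (n : ℕ) (w : List LabelledStep) : Set where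
  field
    dyck       : IsDyckPath n (map unlabel w)
    bijective  : IsPermutation n (φ w)
    increasing : ∀ u a b v → w ≡ u ++ north a ∷ north b ∷ v → a < b

record _Contains_ (π ρ : List ℕ) : Set where
  field
    index      : Fin (length ρ) → Fin (length π)
    monotone   : ∀ a b → a Fin.< b → index a Fin.< index b
    isomorphic : ∀ a b →
      (lookup π (index a) ≤ lookup π (index b)) ⇔ (lookup ρ a ≤ lookup ρ b)

_Avoids_ : List ℕ → List ℕ → Set
π Avoids ρ = ¬ (π Contains ρ)

-- Exactly k elements of A satisfy P: they are the entries of a list of
-- length k without repetitions.
HasCardinality : {A : Set} → (A → Set) → ℕ → Set
HasCardinality {A} P k =
  Σ[ xs ∈ List A ] Unique xs × (∀ x → (x ∈ xs) ⇔ P x) × length xs ≡ k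

-- pf n ⟨ ρs ⟩≐ k says that the number pf_n(ρs) is k.
infix 4 pf_⟨_⟩≐_
pf_⟨_⟩≐_ : ℕ → List (List ℕ) → ℕ → Set
pf n ⟨ ρs ⟩≐ k =
  HasCardinality (λ w → IsParkingFunction n w × All (φ w Avoids_) ρs) k

-- suc k divides the central binomial coefficient, so _/_ does not round here.
catalan : ℕ → ℕ
catalan k = ((2 * k) C k) / suc k

[213] [312] [321] : List ℕ
[213] = 2 ∷ 1 ∷ 3 ∷ []
[312] = 3 ∷ 1 ∷ 2 ∷ []
[321] = 3 ∷ 2 ∷ 1 ∷ []

{-# OPTIONS --safe #-}

-- The patterns 213, 312, 321 are exactly the ones of length 3 that start with a
-- descent, so avoiding them means increasing up to the last entry: the
-- permutation is the identity or arises from it by moving one of 1, …, n − 1 to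
-- the end.  The identity puts no constraint on the path, giving C_n parking
-- functions.  For each of the other n − 1 permutations the last two north steps
-- must not be adjacent; the paths in which they are adjacent correspond, by
-- dropping one of them and an east step, to the Dyck paths of semilength n − 1,
-- which leaves C_n − C_{n−1}.
module Submission where

open import Defs
open import Data.Fin.Base as Fin using (Fin; zero; suc)
open import Data.Integer.Base using (+_; _+_; _-_; _*_; 1ℤ)
import Data.Integer.Properties as ℤ
import Data.Integer.Tactic.RingSolver as ℤ-Ring
open import Data.List.Base using (List; []; _∷_; [_]; _++_; _∷ʳ_; map; length; lookup; concatMap; applyUpTo; initLast; _∷ʳ′_)
open import Data.List.Membership.Propositional using (_∈_; find; lose)
open import Data.List.Membership.Propositional.Properties using (∈-map⁺; ∈-map⁻; ∈-++⁺ˡ; ∈-++⁺ʳ; ∈-++⁻; ∈-concatMap⁺; ∈-concatMap⁻; ∈-lookup)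
open import Data.List.Properties using (length-++; length-map; length-applyUpTo; ∷-injectiveˡ; ∷-injectiveʳ)
open import Data.List.Relation.Binary.Disjoint.Propositional using (Disjoint)
open import Data.List.Relation.Binary.Permutation.Propositional using (_↭_; ↭-refl; ↭-sym; ↭-trans; prep; ↭⇒↭ₛ)
open import Data.List.Relation.Binary.Permutation.Propositional.Properties using (All-resp-↭; ∈-resp-↭; ↭-empty-inv; ↭-singleton-inv; drop-∷; ∷↭∷ʳ; ↭-length)
import Data.List.Relation.Binary.Permutation.Setoid.Properties as ↭ₛ
open import Data.List.Relation.Binary.Pointwise using (Pointwise-≡⇒≡)
open import Data.List.Relation.Unary.All as All using (All; []; _∷_)
import Data.List.Relation.Unary.All.Properties as All
open import Data.List.Relation.Unary.AllPairs as AllPairs using (AllPairs; []; _∷_)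
import Data.List.Relation.Unary.AllPairs.Properties as AllPairs
open import Data.List.Relation.Unary.Any using (here; there)
open import Data.List.Relation.Unary.Linked using (Linked)
open import Data.List.Relation.Unary.Linked.Properties using (AllPairs⇒Linked)
open import Data.List.Relation.Unary.Sorted.TotalOrder.Properties using (↗↭↗⇒≋)
open import Data.List.Relation.Unary.Unique.Propositional using (Unique)
import Data.List.Relation.Unary.Unique.Propositional.Properties as Unique
open import Data.Nat.Base as ℕ using (ℕ; zero; suc; _≤_; _<_; _≥_; _∸_; z≤n; s≤s; z<s; s<s)
open import Data.Nat.Combinatorics using (_C_; nCk≡nC[n∸k]; nC1≡n; nCk+nC[k+1]≡[n+1]C[k+1])
import Data.Nat.DivMod as ℕ
import Data.Nat.Properties as ℕ
import Data.Nat.Tactic.RingSolver as ℕ-Ring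
open import Data.Product.Base using (∃-syntax; _×_; _,_; proj₂; swap)
open import Data.Sum.Base using (inj₁; inj₂)
open import Function.Base using (id; _∘_)
open import Function.Bundles using (_⇔_; mk⇔; Equivalence)
open import Relation.Binary.Definitions using (tri<; tri≈; tri>)
open import Relation.Binary.PropositionalEquality using (_≡_; _≢_; refl; sym; trans; cong; cong₂; subst; subst₂; setoid; module ≡-Reasoning)
open import Relation.Nullary.Decidable.Core using (Dec; yes; no; from-yes)
open import Relation.Nullary.Negation.Core using (¬_; contradiction)
open ≡-Reasoning

-- Ballot numbers and the Catalan formula.

-- ballot d m counts the suffixes of Dyck paths that start d steps above the
-- diagonal and have m north steps.
ballot : ℕ → ℕ → ℕ
ballot d       zero    = 1
ballot zero    (suc m) = ballot 1 m
ballot (suc d) (suc m) = ballot (suc (suc d)) m ℕ.+ ballot d (suc m)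

-- Needed at `d = 0`, where it makes the truncated difference of consecutive Catalan numbers a true
-- difference.
ballot-mono : ∀ d m → ballot d m ≤ ballot d (suc m)
ballot-mono zero    zero    = s≤s z≤n
ballot-mono (suc d) zero    = s≤s z≤n
ballot-mono zero    (suc m) = ballot-mono 1 m
ballot-mono (suc d) (suc m) =
  ℕ.+-mono-≤ (ballot-mono (suc (suc d)) m) (ballot-mono d (suc m))

-- Subtraction-free form of (k + 1) C(n, k + 1) = (n - k) C(n, k), by induction on `n` with Pascal's
-- rule.
binomial-absorption : ∀ n k → suc k ℕ.* (n C suc k) ℕ.+ k ℕ.* (n C k) ≡ n ℕ.* (n C k)
binomial-absorption zero    zero    = refl
binomial-absorption zero    (suc k) = cong₂ ℕ._+_ (ℕ.*-zeroʳ k) (ℕ.*-zeroʳ k)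
binomial-absorption (suc n) zero    =
  trans (ℕ.+-identityʳ _)
    (trans (ℕ.*-identityˡ _) (trans (nC1≡n (suc n)) (sym (ℕ.*-identityʳ (suc n)))))
binomial-absorption (suc n) (suc k) = begin
  suc (suc k) ℕ.* (suc n C suc (suc k)) ℕ.+ suc k ℕ.* (suc n C suc k)
    ≡⟨ cong₂ (λ s t → suc (suc k) ℕ.* s ℕ.+ suc k ℕ.* t) (pascal (suc k)) (pascal k) ⟩
  suc (suc k) ℕ.* (y ℕ.+ z) ℕ.+ suc k ℕ.* (x ℕ.+ y)
    ≡⟨ regroup k x y z ⟩
  (suc (suc k) ℕ.* z ℕ.+ suc k ℕ.* y) ℕ.+ (suc k ℕ.* y ℕ.+ k ℕ.* x) ℕ.+ (x ℕ.+ y)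
    ≡⟨ cong₂ (λ s t → s ℕ.+ t ℕ.+ (x ℕ.+ y)) (binomial-absorption n (suc k)) (binomial-absorption n k) ⟩
  n ℕ.* y ℕ.+ n ℕ.* x ℕ.+ (x ℕ.+ y)
    ≡⟨ collect n x y ⟩
  suc n ℕ.* (x ℕ.+ y)
    ≡⟨ cong (suc n ℕ.*_) (pascal k) ⟨
  suc n ℕ.* (suc n C suc k) ∎
  where
  x = n C k
  y = n C suc k
  z = n C suc (suc k)
  pascal : ∀ j → suc n C suc j ≡ n C j ℕ.+ n C suc j
  pascal j = sym (nCk+nC[k+1]≡[n+1]C[k+1] n j)
  regroup : ∀ k x y z →
    suc (suc k) ℕ.* (y ℕ.+ z) ℕ.+ suc k ℕ.* (x ℕ.+ y) ≡
    (suc (suc k) ℕ.* z ℕ.+ suc k ℕ.* y) ℕ.+ (suc k ℕ.* y ℕ.+ k ℕ.* x) ℕ.+ (x ℕ.+ y)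
  regroup = ℕ-Ring.solve-∀
  collect : ∀ n x y → n ℕ.* y ℕ.+ n ℕ.* x ℕ.+ (x ℕ.+ y) ≡ suc n ℕ.* (x ℕ.+ y)
  collect = ℕ-Ring.solve-∀

-- n over k − 1, with n over −1 read as 0; n C (k ∸ 1) would give 1 there.
_C⁻_ : ℕ → ℕ → ℕ
n C⁻ zero  = 0
n C⁻ suc k = n C k

C⁻-pascal : ∀ n k → n C⁻ k ℕ.+ n C k ≡ suc n C k
C⁻-pascal n zero    = refl
C⁻-pascal n (suc k) = nCk+nC[k+1]≡[n+1]C[k+1] n k

-- The reflection principle: n C⁻ m counts the suffixes that pass below the diagonal.
ballot-closed : ∀ d m {n} → n ≡ d ℕ.+ (m ℕ.+ m) → ballot d m ℕ.+ n C⁻ m ≡ n C m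
ballot-closed d       zero    _    = refl
ballot-closed zero    (suc m) refl = begin
  ballot 1 m ℕ.+ suc n C m
    ≡⟨ cong (ballot 1 m ℕ.+_) (C⁻-pascal n m) ⟨
  ballot 1 m ℕ.+ (n C⁻ m ℕ.+ n C m)
    ≡⟨ ℕ.+-assoc (ballot 1 m) _ _ ⟨
  (ballot 1 m ℕ.+ n C⁻ m) ℕ.+ n C m
    ≡⟨ cong₂ ℕ._+_ (ballot-closed 1 m (ℕ.+-suc m m)) central ⟩
  n C m ℕ.+ n C suc m
    ≡⟨ nCk+nC[k+1]≡[n+1]C[k+1] n m ⟩
  suc n C suc m ∎
  where
  n = m ℕ.+ suc m
  -- On the diagonal the next step must be north, so the recursion has one summand where Pascal's
  -- rule has two. The equality of the two middle entries of row 2m + 1 makes up for this.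
  central : n C m ≡ n C suc m
  central = trans (nCk≡nC[n∸k] (ℕ.m≤m+n m (suc m))) (cong (n C_) (ℕ.m+n∸m≡n m (suc m)))
ballot-closed (suc d) (suc m) refl = begin
  ballot (suc (suc d)) m ℕ.+ ballot d (suc m) ℕ.+ suc n C m
    ≡⟨ cong (ballot (suc (suc d)) m ℕ.+ ballot d (suc m) ℕ.+_) (C⁻-pascal n m) ⟨
  ballot (suc (suc d)) m ℕ.+ ballot d (suc m) ℕ.+ (n C⁻ m ℕ.+ n C m)
    ≡⟨ interchange (ballot (suc (suc d)) m) _ _ _ ⟩
  (ballot (suc (suc d)) m ℕ.+ n C⁻ m) ℕ.+ (ballot d (suc m) ℕ.+ n C m)
    ≡⟨ cong₂ ℕ._+_ (ballot-closed (suc (suc d)) m (shift d m)) (ballot-closed d (suc m) refl) ⟩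
  n C m ℕ.+ n C suc m
    ≡⟨ nCk+nC[k+1]≡[n+1]C[k+1] n m ⟩
  suc n C suc m ∎
  where
  n = d ℕ.+ (suc m ℕ.+ suc m)
  interchange : ∀ a b c e → a ℕ.+ b ℕ.+ (c ℕ.+ e) ≡ (a ℕ.+ c) ℕ.+ (b ℕ.+ e)
  interchange = ℕ-Ring.solve-∀
  shift : ∀ d m → d ℕ.+ (suc m ℕ.+ suc m) ≡ suc (suc d) ℕ.+ (m ℕ.+ m)
  shift = ℕ-Ring.solve-∀

-- Reflection gives `ballot 0 n` as C(2n, n) - C(2n, n - 1), and absorption gives n C(2n, n) = (n +
-- 1) C(2n, n - 1). Stated as a product, the result shows that the division in `catalan` is exact.
suc*ballot≡central : ∀ n → ballot 0 n ℕ.* suc n ≡ (2 ℕ.* n) C n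
suc*ballot≡central zero        = refl
suc*ballot≡central n@(suc m) =
  ℕ.+-cancelʳ-≡ (suc n ℕ.* (2n C m)) _ _ (begin
    ballot 0 n ℕ.* suc n ℕ.+ suc n ℕ.* (2n C m)
      ≡⟨ distrib n (ballot 0 n) (2n C m) ⟩
    suc n ℕ.* (ballot 0 n ℕ.+ 2n C m)
      ≡⟨ cong (suc n ℕ.*_) (ballot-closed 0 n (cong (n ℕ.+_) (ℕ.+-identityʳ n))) ⟩
    2n C n ℕ.+ n ℕ.* (2n C n)
      ≡⟨ cong (2n C n ℕ.+_) absorbed ⟩
    2n C n ℕ.+ suc n ℕ.* (2n C m) ∎)
  where
  2n = 2 ℕ.* n
  distrib : ∀ n b c → b ℕ.* suc n ℕ.+ suc n ℕ.* c ≡ suc n ℕ.* (b ℕ.+ c)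
  distrib = ℕ-Ring.solve-∀
  split : ∀ m c → (2 ℕ.* suc m) ℕ.* c ≡ suc (suc m) ℕ.* c ℕ.+ m ℕ.* c
  split = ℕ-Ring.solve-∀
  absorbed : n ℕ.* (2n C n) ≡ suc n ℕ.* (2n C m)
  absorbed = ℕ.+-cancelʳ-≡ (m ℕ.* (2n C m)) _ _
    (trans (binomial-absorption 2n m) (split m (2n C m)))

ballot≡catalan : ∀ n → ballot 0 n ≡ catalan n
ballot≡catalan n =
  trans (sym (ℕ.m*n/n≡m (ballot 0 n) (suc n))) (cong (ℕ._/ suc n) (suc*ballot≡central n))

-- Completions of parking functions and their enumeration for given labels.

-- Good d b w: w completes a parking function from a point d steps above the
-- diagonal, where the next label must exceed b if it is placed immediately.
-- After an east step b is reset to 0, which restricts nothing.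
data Good : ℕ → ℕ → List LabelledStep → Set where
  end   : ∀ {b} → Good 0 b []
  north : ∀ {d a b w} → b < a → Good (suc d) a w → Good d b (north a ∷ w)
  east  : ∀ {d b w} → Good d 0 w → Good (suc d) b (east ∷ w)

module _ {A P : Set} where

  _when_ : List A → Dec P → List A
  xs when yes _ = xs
  xs when no  _ = []

  when-true : ∀ xs (P? : Dec P) → P → xs when P? ≡ xs
  when-true xs (yes _) _ = refl
  when-true xs (no ¬p) p = contradiction p ¬p

  when-false : ∀ xs (P? : Dec P) → ¬ P → xs when P? ≡ []
  when-false xs (yes p) ¬p = contradiction p ¬p
  when-false xs (no _)  _  = refl

  ∈-when⁻ : ∀ {x xs} (P? : Dec P) → x ∈ xs when P? → P × x ∈ xs
  ∈-when⁻ (yes p) x∈xs = p , x∈xs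

  when-unique : ∀ {xs} (P? : Dec P) → Unique xs → Unique (xs when P?)
  when-unique (yes _) u = u
  when-unique (no _)  _ = []

-- The completions in the sense of `Good d b` whose labels read `π`. Branching on the next step
-- makes their number follow the recursion of `ballot`, except where a label blocks a north step.
words : ℕ → ℕ → List ℕ → List (List LabelledStep)
words zero    b []      = [ [] ]
words (suc d) b []      = map (east ∷_) (words d 0 [])
words zero    b (a ∷ π) = map (north a ∷_) (words 1 a π) when (b ℕ.<? a)
words (suc d) b (a ∷ π) =
  map (north a ∷_) (words (suc (suc d)) a π) when (b ℕ.<? a)
    ++ map (east ∷_) (words d 0 (a ∷ π))

∈-words-north : ∀ d π {a b w} → b < a → w ∈ words (suc d) a π → north a ∷ w ∈ words d b (a ∷ π)
∈-words-north zero π {a} {b} b<a w∈ =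
  subst (_ ∈_) (sym (when-true _ (b ℕ.<? a) b<a)) (∈-map⁺ _ w∈)
∈-words-north (suc d) π {a} {b} b<a w∈ =
  ∈-++⁺ˡ (subst (_ ∈_) (sym (when-true _ (b ℕ.<? a) b<a)) (∈-map⁺ _ w∈))

∈-words-east : ∀ {d} b π {w} → w ∈ words d 0 π → east ∷ w ∈ words (suc d) b π
∈-words-east b []      w∈ = ∈-map⁺ _ w∈
∈-words-east b (a ∷ π) w∈ = ∈-++⁺ʳ _ (∈-map⁺ _ w∈)

good⇒∈-words : ∀ {d b w} → Good d b w → w ∈ words d b (φ w)
good⇒∈-words end                = here refl
good⇒∈-words (north {w = w} b<a g) = ∈-words-north _ (φ w) b<a (good⇒∈-words g)
good⇒∈-words (east {w = w} g)   = ∈-words-east _ (φ w) (good⇒∈-words g)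

∈-words⇒good : ∀ d b π {w} → w ∈ words d b π → Good d b w × φ w ≡ π
∈-words⇒good-north : ∀ d b a π {w} →
  w ∈ map (north a ∷_) (words (suc d) a π) when (b ℕ.<? a) → Good d b w × φ w ≡ a ∷ π
∈-words⇒good-east : ∀ d b π {w} →
  w ∈ map (east ∷_) (words d 0 π) → Good (suc d) b w × φ w ≡ π

∈-words⇒good zero    b []      (here refl) = end , refl
∈-words⇒good (suc d) b []      w∈ = ∈-words⇒good-east d b [] w∈
∈-words⇒good zero    b (a ∷ π) w∈ = ∈-words⇒good-north zero b a π w∈
∈-words⇒good (suc d) b (a ∷ π) w∈
  with ∈-++⁻ (map (north a ∷_) (words (suc (suc d)) a π) when (b ℕ.<? a)) w∈
... | inj₁ w∈ˡ = ∈-words⇒good-north (suc d) b a π w∈ˡ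
... | inj₂ w∈ʳ = ∈-words⇒good-east d b (a ∷ π) w∈ʳ

∈-words⇒good-north d b a π w∈
  with b<a , w∈′ ← ∈-when⁻ (b ℕ.<? a) w∈
  with v , v∈ , refl ← ∈-map⁻ (north a ∷_) w∈′
  with g , refl ← ∈-words⇒good (suc d) a π v∈ = north b<a g , refl

∈-words⇒good-east d b π w∈
  with v , v∈ , refl ← ∈-map⁻ (east ∷_) w∈
  with g , refl ← ∈-words⇒good d 0 π v∈ = east g , refl

words-unique : ∀ d b π → Unique (words d b π)
words-unique zero    b []      = [] ∷ []
words-unique (suc d) b []      = Unique.map⁺ ∷-injectiveʳ (words-unique d 0 [])
words-unique zero    b (a ∷ π) =
  when-unique (b ℕ.<? a) (Unique.map⁺ ∷-injectiveʳ (words-unique 1 a π))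
words-unique (suc d) b (a ∷ π) =
  Unique.++⁺
    (when-unique (b ℕ.<? a) (Unique.map⁺ ∷-injectiveʳ (words-unique (suc (suc d)) a π)))
    (Unique.map⁺ ∷-injectiveʳ (words-unique d 0 (a ∷ π)))
    disjoint
  where
  disjoint : Disjoint (map (north a ∷_) (words (suc (suc d)) a π) when (b ℕ.<? a))
                      (map (east ∷_) (words d 0 (a ∷ π)))
  disjoint (w∈ˡ , w∈ʳ)
    with _ , _ , refl ← ∈-map⁻ (north a ∷_) (proj₂ (∈-when⁻ (b ℕ.<? a) w∈ˡ))
    with ∈-map⁻ (east ∷_) w∈ʳ
  ... | _ , _ , ()

-- Counting completions for sorted labels and for a descent at the end.

length-words-zero : ∀ {a b} π → b < a → length (words 0 b (a ∷ π)) ≡ length (words 1 a π)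
length-words-zero {a} {b} π b<a =
  trans (cong length (when-true _ (b ℕ.<? a) b<a)) (length-map _ (words 1 a π))

length-words-suc : ∀ d {a b} π → b < a →
  length (words (suc d) b (a ∷ π)) ≡
  length (words (suc (suc d)) a π) ℕ.+ length (words d 0 (a ∷ π))
length-words-suc d {a} {b} π b<a =
  trans (length-++ (map (north a ∷_) (words (suc (suc d)) a π) when (b ℕ.<? a)))
    (cong₂ ℕ._+_
      (trans (cong length (when-true _ (b ℕ.<? a) b<a)) (length-map _ (words (suc (suc d)) a π)))
      (length-map _ (words d 0 (a ∷ π))))

length-words-blocked : ∀ d {a b} π → ¬ (b < a) →
  length (words (suc d) b (a ∷ π)) ≡ length (words d 0 (a ∷ π))
length-words-blocked d {a} {b} π b≮a =
  trans (length-++ (map (north a ∷_) (words (suc (suc d)) a π) when (b ℕ.<? a)))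
    (cong₂ ℕ._+_
      (cong length (when-false _ (b ℕ.<? a) b≮a))
      (length-map _ (words d 0 (a ∷ π))))

-- Increasing labels pass every test `b < a`, so no branch is lost and the recursion is exactly that
-- of `ballot`.
length-words-sorted : ∀ d {b} π → AllPairs _<_ (b ∷ π) →
  length (words d b π) ≡ ballot d (length π)
length-words-sorted zero    []      _ = refl
length-words-sorted (suc d) []      s =
  trans (length-map _ (words d 0 [])) (length-words-sorted d [] ([] ∷ []))
length-words-sorted zero    (a ∷ π) ((b<a ∷ _) ∷ s) =
  trans (length-words-zero π b<a) (length-words-sorted 1 π s)
length-words-sorted (suc d) (a ∷ π) ((b<a ∷ b<π) ∷ s) =
  trans (length-words-suc d π b<a)
    (cong₂ ℕ._+_
      (length-words-sorted (suc (suc d)) π s)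
      -- The east step resets the bound to 0, which is below all labels because they exceed `b`.
      (length-words-sorted d (a ∷ π) (All.map (ℕ.≤-<-trans z≤n) (b<a ∷ b<π) ∷ s)))

-- b is the label preceding π, and m + 2 is the length of π.
data LateDescent : ℕ → ℕ → List ℕ → Set where
  here  : ∀ {b c x} → b < c → 0 < x → x < c → LateDescent b 0 (c ∷ x ∷ [])
  there : ∀ {b c m π} → b < c → LateDescent c m π → LateDescent b (suc m) (c ∷ π)

lateDescent-0 : ∀ {b m π} → LateDescent b m π → LateDescent 0 m π
lateDescent-0 (here b<c 0<x x<c) = here (ℕ.≤-<-trans z≤n b<c) 0<x x<c
lateDescent-0 (there b<c l)      = there (ℕ.≤-<-trans z≤n b<c) l

-- The descent forbids a north step, so an east step to height `d` is forced; after it the last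
-- label is unrestricted.
length-words-here : ∀ d {x c} → 0 < x → x < c →
  length (words (suc d) c (x ∷ [])) ≡ ballot d 1
length-words-here d 0<x x<c =
  trans (length-words-blocked d [] (ℕ.<-asym x<c))
    (length-words-sorted d _ ((0<x ∷ []) ∷ [] ∷ []))

-- Subtracted are the paths whose last two north steps are adjacent; dropping
-- one of them, with an east step, gives a path with one north step fewer.
length-words-lateDescent : ∀ d {b m π} → LateDescent b m π →
  length (words d b π) ℕ.+ ballot d (suc m) ≡ ballot d (suc (suc m))
length-words-lateDescent zero (here {c = c} {x} b<c 0<x x<c) =
  cong (ℕ._+ 1)
    (trans (length-words-zero (x ∷ []) b<c)
      (length-words-here 0 0<x x<c))
length-words-lateDescent (suc d) l@(here {c = c} {x} b<c 0<x x<c) = begin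
  -- The summand 1 is `ballot (suc (suc d)) 0`, from unfolding `ballot (suc d) 1`. In the last line
  -- `1 + ballot (suc d) 1` is folded back in the same way into `ballot (suc (suc d)) 1`.
  length (words (suc d) _ (c ∷ x ∷ [])) ℕ.+ (1 ℕ.+ ballot d 1)
    ≡⟨ cong (ℕ._+ (1 ℕ.+ ballot d 1)) (length-words-suc d (x ∷ []) b<c) ⟩
  length (words (suc (suc d)) c (x ∷ [])) ℕ.+ length (words d 0 (c ∷ x ∷ [])) ℕ.+ (1 ℕ.+ ballot d 1)
    ≡⟨ cong (λ k → k ℕ.+ length (words d 0 (c ∷ x ∷ [])) ℕ.+ (1 ℕ.+ ballot d 1))
            (length-words-here (suc d) 0<x x<c) ⟩
  ballot (suc d) 1 ℕ.+ length (words d 0 (c ∷ x ∷ [])) ℕ.+ (1 ℕ.+ ballot d 1)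
    ≡⟨ regroup (ballot (suc d) 1) _ (ballot d 1) ⟩
  1 ℕ.+ ballot (suc d) 1 ℕ.+ (length (words d 0 (c ∷ x ∷ [])) ℕ.+ ballot d 1)
    ≡⟨ cong (1 ℕ.+ ballot (suc d) 1 ℕ.+_) (length-words-lateDescent d (lateDescent-0 l)) ⟩
  ballot (suc (suc d)) 1 ℕ.+ ballot d 2 ∎
  where
  regroup : ∀ p q r → p ℕ.+ q ℕ.+ (1 ℕ.+ r) ≡ 1 ℕ.+ p ℕ.+ (q ℕ.+ r)
  regroup = ℕ-Ring.solve-∀
length-words-lateDescent zero (there {π = π} b<c l) =
  trans (cong (ℕ._+ _) (length-words-zero π b<c)) (length-words-lateDescent 1 l)
length-words-lateDescent (suc d) (there {c = c} {m} {π} b<c l) = begin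
  length (words (suc d) _ (c ∷ π)) ℕ.+ (ballot (suc (suc d)) (suc m) ℕ.+ ballot d (suc (suc m)))
    ≡⟨ cong (ℕ._+ (ballot (suc (suc d)) (suc m) ℕ.+ ballot d (suc (suc m)))) (length-words-suc d π b<c) ⟩
  length (words (suc (suc d)) c π) ℕ.+ length (words d 0 (c ∷ π))
    ℕ.+ (ballot (suc (suc d)) (suc m) ℕ.+ ballot d (suc (suc m)))
    ≡⟨ regroup (length (words (suc (suc d)) c π)) _ _ _ ⟩
  (length (words (suc (suc d)) c π) ℕ.+ ballot (suc (suc d)) (suc m))
    ℕ.+ (length (words d 0 (c ∷ π)) ℕ.+ ballot d (suc (suc m)))
    ≡⟨ cong₂ ℕ._+_ (length-words-lateDescent (suc (suc d)) l)
         (length-words-lateDescent d (lateDescent-0 (there b<c l))) ⟩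
  ballot (suc (suc d)) (suc (suc m)) ℕ.+ ballot d (suc (suc (suc m))) ∎
  where
  regroup : ∀ p q r s → p ℕ.+ q ℕ.+ (r ℕ.+ s) ≡ (p ℕ.+ r) ℕ.+ (q ℕ.+ s)
  regroup = ℕ-Ring.solve-∀

-- Agreement of the inductive and the prefix-based description of paths.

-- The conditions on a parking function, generalised to a start at height `d` so that induction on
-- the word applies. The field `first` keeps the comparison with a label that precedes the suffix.
record Suffix (d b : ℕ) (w : List LabelledStep) : Set where
  field
    balanced   : #E (map unlabel w) ≡ d ℕ.+ #N (map unlabel w)
    neverBelow : ∀ u v → map unlabel w ≡ u ++ v → #E u ≤ d ℕ.+ #N u
    first      : ∀ a v → w ≡ north a ∷ v → b < a
    increasing : ∀ u a b v → w ≡ u ++ north a ∷ north b ∷ v → a < b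

suffix⇒good : ∀ d b w → All (0 <_) (φ w) → Suffix d b w → Good d b w
suffix⇒good zero b [] _ _ = end
suffix⇒good (suc d) b [] _ s with () ← Suffix.balanced s
suffix⇒good d b (north a ∷ w) (_ ∷ 0<w) s =
  north (first a w refl) (suffix⇒good (suc d) a w 0<w record
    { balanced   = trans balanced (ℕ.+-suc d _)
    ; neverBelow = λ u v e →
        subst (#E u ≤_) (ℕ.+-suc d _) (neverBelow (N ∷ u) v (cong (N ∷_) e))
    ; first      = λ c v e → increasing [] a c v (cong (north a ∷_) e)
    ; increasing = λ u c c′ v e → increasing (north a ∷ u) c c′ v (cong (north a ∷_) e)
    })
  where open Suffix s
suffix⇒good zero b (east ∷ w) _ s with () ← Suffix.neverBelow s (E ∷ []) _ refl
suffix⇒good (suc d) b (east ∷ w) 0<w s =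
  east (suffix⇒good d 0 w 0<w record
    { balanced   = ℕ.suc-injective balanced
    ; neverBelow = λ u v e → ℕ.s≤s⁻¹ (neverBelow (E ∷ u) v (cong (E ∷_) e))
    -- After an east step the bound is 0, so positivity of the labels is what `first` requires.
    ; first      = λ { a v refl → All.head 0<w }
    ; increasing = λ u c c′ v e → increasing (east ∷ u) c c′ v (cong (east ∷_) e)
    })
  where open Suffix s

good⇒suffix : ∀ {d b w} → Good d b w → Suffix d b w
good⇒suffix end = record
  { balanced   = refl
  ; neverBelow = λ { [] v _ → z≤n }
  ; first      = λ _ _ ()
  ; increasing = λ { [] _ _ _ () ; (_ ∷ _) _ _ _ () }
  }
good⇒suffix {d} (north {a = a} b<a g) = record
  { balanced   = trans balanced (sym (ℕ.+-suc d _))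
  ; neverBelow = λ
      { []      v e → z≤n
      ; (N ∷ u) v e → subst (#E u ≤_) (sym (ℕ.+-suc d _)) (neverBelow u v (∷-injectiveʳ e)) }
  ; first      = λ { _ _ refl → b<a }
  ; increasing = λ
      { []      _ c v refl → first c v refl
      ; (_ ∷ u) c c′ v e   → increasing u c c′ v (∷-injectiveʳ e) }
  }
  where open Suffix (good⇒suffix g)
good⇒suffix (east g) = record
  { balanced   = cong suc balanced
  ; neverBelow = λ
      { []      v e → z≤n
      ; (E ∷ u) v e → s≤s (neverBelow u v (∷-injectiveʳ e)) }
  ; first      = λ _ _ ()
  ; increasing = λ
      { []      _ _ _ ()
      ; (_ ∷ u) c c′ v e → increasing u c c′ v (∷-injectiveʳ e) }
  }
  where open Suffix (good⇒suffix g)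

#N-unlabel : ∀ w → #N (map unlabel w) ≡ length (φ w)
#N-unlabel []            = refl
#N-unlabel (north _ ∷ w) = cong suc (#N-unlabel w)
#N-unlabel (east ∷ w)    = #N-unlabel w

-- The candidate permutations.

-- For increasing xs, the rearrangements of xs that avoid the three patterns are
-- xs itself and bumps xs.
bumps : List ℕ → List (List ℕ)
bumps []           = []
bumps (x ∷ [])     = []
bumps (x ∷ y ∷ ys) = (y ∷ ys ∷ʳ x) ∷ map (x ∷_) (bumps (y ∷ ys))

length-bumps : ∀ x xs → length (bumps (x ∷ xs)) ≡ length xs
length-bumps x []       = refl
length-bumps x (y ∷ ys) = cong suc (trans (length-map _ (bumps (y ∷ ys))) (length-bumps y ys))

-- The moved entry is smaller than everything it passes, so the only descent is the one into the
-- last position.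
moved-lateDescent : ∀ {b x y} ys → b < y → 0 < x → AllPairs _<_ (x ∷ y ∷ ys) →
  LateDescent b (length ys) (y ∷ ys ∷ʳ x)
moved-lateDescent []       b<y 0<x ((x<y ∷ _) ∷ _) = here b<y 0<x x<y
moved-lateDescent (z ∷ zs) b<y 0<x ((_ ∷ x<zs) ∷ (y<z ∷ _) ∷ s) =
  there b<y (moved-lateDescent zs y<z 0<x (x<zs ∷ s))

bumps-lateDescent : ∀ {b} x y ys → AllPairs _<_ (b ∷ x ∷ y ∷ ys) →
  All (LateDescent b (length ys)) (bumps (x ∷ y ∷ ys))
bumps-lateDescent {b} x y ys ((b<x ∷ b<y ∷ _) ∷ s) =
  moved-lateDescent ys b<y (ℕ.≤-<-trans z≤n b<x) s ∷ kept ys s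
  where
  kept : ∀ ys → AllPairs _<_ (x ∷ y ∷ ys) →
    All (LateDescent b (length ys)) (map (x ∷_) (bumps (y ∷ ys)))
  kept []       _ = []
  kept (z ∷ zs) s = All.map⁺ (All.map (there b<x) (bumps-lateDescent y z zs s))

candidates : List ℕ → List (List ℕ)
candidates xs = xs ∷ bumps xs

candidates-∷ : ∀ x {π xs} → π ∈ candidates xs → x ∷ π ∈ candidates (x ∷ xs)
candidates-∷ x {xs = xs}     (here refl) = here refl
candidates-∷ x {xs = _ ∷ _}  (there π∈)  = there (there (∈-map⁺ (x ∷_) π∈))

-- Moving `x` to the end changes the head from `x` to the larger `y`; the other candidates keep `x`
-- and differ in their tails.
candidates-unique : ∀ {xs} → AllPairs _<_ xs → Unique (candidates xs)
candidates-unique {[]}         _  = [] ∷ []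
candidates-unique {x ∷ []}     _  = [] ∷ []
candidates-unique {x ∷ y ∷ ys} ((x<y ∷ _) ∷ s)
  with y∷ys≢ ∷ unique ← candidates-unique s =
    ((x≢y ∘ ∷-injectiveˡ) ∷ All.map⁺ (All.map (λ ≢π → ≢π ∘ ∷-injectiveʳ) y∷ys≢))
    ∷ All.map⁺ (All.universal (λ _ → x≢y ∘ sym ∘ ∷-injectiveˡ) _)
    ∷ Unique.map⁺ ∷-injectiveʳ unique
  where
  x≢y : x ≢ y
  x≢y = ℕ.<⇒≢ x<y

candidates-↭ : ∀ {π} xs → π ∈ candidates xs → π ↭ xs
candidates-↭ xs           (here refl)         = ↭-refl
candidates-↭ (x ∷ y ∷ ys) (there (here refl)) = ↭-sym (∷↭∷ʳ x (y ∷ ys))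
candidates-↭ (x ∷ y ∷ ys) (there (there π∈))
  with _ , π′∈ , refl ← ∈-map⁻ (x ∷_) π∈ = prep x (candidates-↭ (y ∷ ys) (there π′∈))

sorted-↭⇒≡ : ∀ {xs ys} → AllPairs _<_ xs → AllPairs _<_ ys → xs ↭ ys → xs ≡ ys
sorted-↭⇒≡ s t xs↭ys =
  Pointwise-≡⇒≡ (↗↭↗⇒≋ ℕ.≤-totalOrder (sorted s) (sorted t) (↭⇒↭ₛ xs↭ys))
  where
  sorted : ∀ {xs} → AllPairs _<_ xs → Linked _≤_ xs
  sorted s = AllPairs⇒Linked (AllPairs.map ℕ.<⇒≤ s)

head-≤ : ∀ {x xs y} → AllPairs _<_ (x ∷ xs) → y ∈ x ∷ xs → x ≤ y
head-≤ _        (here refl) = ℕ.≤-refl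
head-≤ (x< ∷ _) (there y∈)  = ℕ.<⇒≤ (All.lookup x< y∈)

-- Compare the head `s` with the minimum `y` of `xs`. It cannot be smaller. If equal, both heads are
-- dropped. If larger, `y` is below all of `σ`, so it is the last entry, and `σ` is the sorted rest.
∷ʳ-∈-candidates : ∀ {σ x xs} → AllPairs _<_ σ → AllPairs _<_ xs →
  σ ∷ʳ x ↭ xs → σ ∷ʳ x ∈ candidates xs
∷ʳ-∈-candidates {[]}    {x} _ _ σx↭ = here (sym (↭-singleton-inv (↭-sym σx↭)))
∷ʳ-∈-candidates {s ∷ σ} {x} {[]} _ _ σx↭ with () ← ↭-empty-inv σx↭
∷ʳ-∈-candidates {s ∷ σ} {x} {y ∷ ys} <σ <ys σx↭ with ℕ.<-cmp s y
... | tri< s<y _ _ = contradiction (head-≤ <ys (∈-resp-↭ σx↭ (here refl))) (ℕ.<⇒≱ s<y)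
... | tri≈ _ refl _ =
  candidates-∷ s (∷ʳ-∈-candidates (AllPairs.tail <σ) (AllPairs.tail <ys) (drop-∷ σx↭))
... | tri> _ _ y<s with ∈-++⁻ (s ∷ σ) (∈-resp-↭ (↭-sym σx↭) (here refl))
...   | inj₁ y∈ = contradiction (head-≤ <σ y∈) (ℕ.<⇒≱ y<s)
...   | inj₂ (here refl)
  with refl ← sorted-↭⇒≡ <σ (AllPairs.tail <ys) (drop-∷ (↭-trans (∷↭∷ʳ y (s ∷ σ)) σx↭))
  = there (here refl)

-- Pattern avoidance as increase up to the last entry.

-- The position `k` only witnesses that `j` is not last. Quantifying over triples matches
-- occurrences of patterns of length 3.
EarlyAscents : List ℕ → Set
EarlyAscents π = ∀ {i j k : Fin (length π)} → i Fin.< j → j Fin.< k → lookup π i < lookup π j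

AllPairs-lookup : ∀ {A : Set} {R : A → A → Set} {xs} → AllPairs R xs →
  ∀ {i j} → i Fin.< j → R (lookup xs i) (lookup xs j)
AllPairs-lookup (Rx ∷ _) {zero}  {suc j} _         = All.lookup Rx (∈-lookup j)
AllPairs-lookup (_ ∷ Rs) {suc i} {suc j} (s<s i<j) = AllPairs-lookup Rs i<j

earlyAscents-∷ : ∀ {x π} → (∀ {j k : Fin (length π)} → j Fin.< k → x < lookup π j) →
  EarlyAscents π → EarlyAscents (x ∷ π)
earlyAscents-∷ x< _ {zero}  {suc j} {suc k} _         (s<s j<k) = x< j<k
earlyAscents-∷ _ as {suc i} {suc j} {suc k} (s<s i<j) (s<s j<k) = as i<j j<k

earlyAscents-∷ʳ : ∀ {σ x} → AllPairs _<_ σ → EarlyAscents (σ ∷ʳ x)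
earlyAscents-∷ʳ []       {zero} {suc ()}
earlyAscents-∷ʳ (s< ∷ s) = earlyAscents-∷ (lookup-init s<) (earlyAscents-∷ʳ s)
  where
  lookup-init : ∀ {P : ℕ → Set} {σ x} → All P σ →
    ∀ {j k : Fin (length (σ ∷ʳ x))} → j Fin.< k → P (lookup (σ ∷ʳ x) j)
  lookup-init []       {zero} {suc ()}
  lookup-init (p ∷ _)  {zero}          _         = p
  lookup-init (_ ∷ ps) {suc j} {suc k} (s<s j<k) = lookup-init ps j<k

earlyAscents⇒sorted : ∀ σ {x} → EarlyAscents (σ ∷ʳ x) → AllPairs _<_ σ
earlyAscents⇒sorted []      _  = []
earlyAscents⇒sorted (s ∷ σ) as =
  init-all σ (λ j<k → as {zero} z<s (s<s j<k))
    ∷ earlyAscents⇒sorted σ (λ i<j j<k → as (s<s i<j) (s<s j<k))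
  where
  init-all : ∀ {P : ℕ → Set} σ {x} →
    (∀ {j k : Fin (length (σ ∷ʳ x))} → j Fin.< k → P (lookup (σ ∷ʳ x) j)) → All P σ
  init-all []           _ = []
  init-all (t ∷ [])     p = p {zero} {suc zero} z<s ∷ []
  init-all (t ∷ u ∷ σ)  p = p {zero} {suc zero} z<s ∷ init-all (u ∷ σ) (λ j<k → p (s<s j<k))

candidates-earlyAscents : ∀ {π xs} → AllPairs _<_ xs → π ∈ candidates xs → EarlyAscents π
candidates-earlyAscents s (here refl) i<j _ = AllPairs-lookup s i<j
candidates-earlyAscents {xs = x ∷ y ∷ ys} (_ ∷ s) (there (here refl)) = earlyAscents-∷ʳ s
candidates-earlyAscents {xs = x ∷ y ∷ ys} (x< ∷ s) (there (there π∈))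
  with _ , π′∈ , refl ← ∈-map⁻ (x ∷_) π∈ =
    earlyAscents-∷
      (λ {j} _ → All.lookup (All-resp-↭ (↭-sym (candidates-↭ _ (there π′∈))) x<) (∈-lookup j))
      (candidates-earlyAscents s (there π′∈))

earlyAscents⇒∈-candidates : ∀ {π xs} → AllPairs _<_ xs → π ↭ xs → EarlyAscents π → π ∈ candidates xs
earlyAscents⇒∈-candidates {π} s π↭ as with initLast π
... | []      = here (sym (↭-empty-inv (↭-sym π↭)))
... | σ ∷ʳ′ _ = ∷ʳ-∈-candidates (earlyAscents⇒sorted σ as) s π↭

-- `isomorphic` ranges over ordered pairs of positions, so each pair `i < j` must supply both
-- comparisons.
SameOrder : (a b c d : ℕ) → Set
SameOrder a b c d = ((a ≤ b) ⇔ (c ≤ d)) × ((b ≤ a) ⇔ (d ≤ c))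

sameOrder-< : ∀ {a b c d} → a < b → c < d → SameOrder a b c d
sameOrder-< a<b c<d =
    mk⇔ (λ _ → ℕ.<⇒≤ c<d) (λ _ → ℕ.<⇒≤ a<b)
  , mk⇔ (λ b≤a → contradiction b≤a (ℕ.<⇒≱ a<b)) (λ d≤c → contradiction d≤c (ℕ.<⇒≱ c<d))

sameOrder-> : ∀ {a b c d} → b < a → d < c → SameOrder a b c d
sameOrder-> b<a d<c = swap (sameOrder-< b<a d<c)

contains-triple : ∀ {π i j k r s t} → i Fin.< j → j Fin.< k →
  SameOrder (lookup π i) (lookup π j) r s →
  SameOrder (lookup π i) (lookup π k) r t →
  SameOrder (lookup π j) (lookup π k) s t →
  π Contains (r ∷ s ∷ t ∷ [])
contains-triple {π} {i} {j} {k} {r} {s} {t} i<j j<k (ij , ji) (ik , ki) (jk , kj) = record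
  { index      = index
  ; monotone   = monotone
  ; isomorphic = isomorphic
  }
  where
  index : Fin 3 → Fin (length π)
  index zero             = i
  index (suc zero)       = j
  index (suc (suc zero)) = k
  monotone : ∀ a b → a Fin.< b → index a Fin.< index b
  monotone zero       (suc zero)       _ = i<j
  monotone zero       (suc (suc zero)) _ = ℕ.<-trans i<j j<k
  monotone (suc zero) (suc (suc zero)) _ = j<k
  monotone (suc zero) (suc zero) (s<s ())
  monotone (suc (suc zero)) (suc zero) (s<s ())
  monotone (suc (suc zero)) (suc (suc zero)) (s<s (s<s ()))
  diagonal : ∀ {a b} → (a ≤ a) ⇔ (b ≤ b)
  diagonal = mk⇔ (λ _ → ℕ.≤-refl) (λ _ → ℕ.≤-refl)
  isomorphic : ∀ a b →
    (lookup π (index a) ≤ lookup π (index b)) ⇔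
    (lookup (r ∷ s ∷ t ∷ []) a ≤ lookup (r ∷ s ∷ t ∷ []) b)
  isomorphic zero             zero             = diagonal
  isomorphic zero             (suc zero)       = ij
  isomorphic zero             (suc (suc zero)) = ik
  isomorphic (suc zero)       zero             = ji
  isomorphic (suc zero)       (suc zero)       = diagonal
  isomorphic (suc zero)       (suc (suc zero)) = jk
  isomorphic (suc (suc zero)) zero             = ki
  isomorphic (suc (suc zero)) (suc zero)       = kj
  isomorphic (suc (suc zero)) (suc (suc zero)) = diagonal

-- An occurrence would have a descent at its first two positions with a third position after them.
-- The value of `t` is arbitrary, so all three patterns are covered.
earlyAscents⇒avoids : ∀ {π r s t} → EarlyAscents π → s < r → π Avoids (r ∷ s ∷ t ∷ [])
earlyAscents⇒avoids as s<r c =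
  ℕ.<⇒≱ s<r (Equivalence.to (isomorphic zero (suc zero))
    (ℕ.<⇒≤ (as (monotone zero (suc zero) z<s) (monotone (suc zero) (suc (suc zero)) (s<s z<s)))))
  where open _Contains_ c

-- Given a descent at `i < j` with `k` after it, the third value is above both, between them or
-- below both, which gives 213, 312 or 321 respectively. Distinctness of the entries excludes ties.
avoids⇒earlyAscents : ∀ {π} → Unique π →
  All (π Avoids_) ([213] ∷ [312] ∷ [321] ∷ []) → EarlyAscents π
avoids⇒earlyAscents {π} unique (¬213 ∷ ¬312 ∷ ¬321 ∷ []) {i} {j} {k} i<j j<k
  with ℕ.<-cmp (lookup π i) (lookup π j)
... | tri< a<b _ _ = a<b
... | tri≈ _ a≡b _ = contradiction a≡b (AllPairs-lookup unique i<j)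
... | tri> _ _ b<a with ℕ.<-cmp (lookup π i) (lookup π k)
...   | tri≈ _ a≡c _ = contradiction a≡c (AllPairs-lookup unique (ℕ.<-trans i<j j<k))
...   | tri< a<c _ _ = contradiction
  (contains-triple i<j j<k
    (sameOrder-> b<a (from-yes (1 ℕ.<? 2)))
    (sameOrder-< a<c (from-yes (2 ℕ.<? 3)))
    (sameOrder-< (ℕ.<-trans b<a a<c) (from-yes (1 ℕ.<? 3))))
  ¬213
...   | tri> _ _ c<a with ℕ.<-cmp (lookup π j) (lookup π k)
...     | tri≈ _ b≡c _ = contradiction b≡c (AllPairs-lookup unique j<k)
...     | tri< b<c _ _ = contradiction
  (contains-triple i<j j<k
    (sameOrder-> b<a (from-yes (1 ℕ.<? 3)))
    (sameOrder-> c<a (from-yes (2 ℕ.<? 3)))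
    (sameOrder-< b<c (from-yes (1 ℕ.<? 2))))
  ¬312
...     | tri> _ _ c<b = contradiction
  (contains-triple i<j j<k
    (sameOrder-> b<a (from-yes (2 ℕ.<? 3)))
    (sameOrder-> c<a (from-yes (1 ℕ.<? 3)))
    (sameOrder-> c<b (from-yes (1 ℕ.<? 2))))
  ¬321

-- Assembling the enumeration and its length.

length-concatMap-const : ∀ {A B : Set} (f : A → List B) {k xs} →
  All (λ x → length (f x) ≡ k) xs → length (concatMap f xs) ≡ length xs ℕ.* k
length-concatMap-const f []                     = refl
length-concatMap-const f {xs = x ∷ xs} (eq ∷ eqs) =
  trans (length-++ (f x)) (cong₂ ℕ._+_ eq (length-concatMap-const f eqs))

-- The leading 0 serves as the initial bound in `words 0 0`, and its comparisons say that all labels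
-- are positive.
numbers-sorted : ∀ n → AllPairs _<_ (0 ∷ applyUpTo suc n)
numbers-sorted n = AllPairs.applyUpTo⁺₁ id (suc n) (λ i<j _ → i<j)

enumeration : ℕ → List (List LabelledStep)
enumeration n = concatMap (words 0 0) (candidates (applyUpTo suc n))

-- Words from different candidates differ because `φ` recovers the candidate.
enumeration-unique : ∀ n → Unique (enumeration n)
enumeration-unique n =
  Unique.concat⁺
    (All.map⁺ (All.universal (words-unique 0 0) (candidates (applyUpTo suc n))))
    (AllPairs.map⁺ (AllPairs.map disjoint (candidates-unique (AllPairs.tail (numbers-sorted n)))))
  where
  disjoint : ∀ {π ρ} → π ≢ ρ → Disjoint (words 0 0 π) (words 0 0 ρ)
  disjoint π≢ρ (w∈π , w∈ρ) =
    π≢ρ (trans (sym (proj₂ (∈-words⇒good 0 0 _ w∈π))) (proj₂ (∈-words⇒good 0 0 _ w∈ρ)))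

parking⇒good : ∀ {n w} → IsParkingFunction n w → Good 0 0 w
parking⇒good {n} {w} p = suffix⇒good 0 0 w 0<w record
  { balanced   = trans easts (sym norths)
  ; neverBelow = neverBelow
  ; first      = λ { _ _ refl → All.head 0<w }
  ; increasing = increasing
  }
  where
  open IsParkingFunction p
  open IsDyckPath dyck
  0<w : All (0 <_) (φ w)
  0<w = All-resp-↭ (↭-sym bijective) (AllPairs.head (numbers-sorted n))

good⇒parking : ∀ {n w} → Good 0 0 w → φ w ↭ applyUpTo suc n → IsParkingFunction n w
good⇒parking {n} {w} g φ↭ = record
  { dyck       = record
    { norths     = norths
    ; easts      = trans balanced norths
    ; neverBelow = neverBelow
    }
  ; bijective  = φ↭
  ; increasing = increasing
  }
  where
  open Suffix (good⇒suffix g)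
  norths : #N (map unlabel w) ≡ n
  norths = trans (#N-unlabel w) (trans (↭-length φ↭) (length-applyUpTo suc n))

∈-enumeration : ∀ n w → (w ∈ enumeration n) ⇔
  (IsParkingFunction n w × All (φ w Avoids_) ([213] ∷ [312] ∷ [321] ∷ []))
∈-enumeration n w = mk⇔ to from
  where
  sorted : AllPairs _<_ (applyUpTo suc n)
  sorted = AllPairs.tail (numbers-sorted n)
  to : w ∈ enumeration n → IsParkingFunction n w × All (φ w Avoids_) ([213] ∷ [312] ∷ [321] ∷ [])
  to w∈
    with π , π∈ , w∈π ← find (∈-concatMap⁻ (words 0 0) w∈)
    with g , refl ← ∈-words⇒good 0 0 π w∈π
    = good⇒parking g (candidates-↭ _ π∈)
    , avoids (from-yes (1 ℕ.<? 2)) ∷ avoids (from-yes (1 ℕ.<? 3)) ∷ avoids (from-yes (2 ℕ.<? 3)) ∷ []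
    where
    avoids : ∀ {r s t} → s < r → φ w Avoids (r ∷ s ∷ t ∷ [])
    avoids = earlyAscents⇒avoids (candidates-earlyAscents sorted π∈)
  from : IsParkingFunction n w × All (φ w Avoids_) ([213] ∷ [312] ∷ [321] ∷ []) → w ∈ enumeration n
  from (p , avoids) =
    ∈-concatMap⁺ (words 0 0)
      (lose {P = λ π → w ∈ words 0 0 π} (earlyAscents⇒∈-candidates sorted bijective (avoids⇒earlyAscents unique avoids))
            (good⇒∈-words (parking⇒good p)))
    where
    open IsParkingFunction p
    unique : Unique (φ w)
    unique = ↭ₛ.Unique-resp-↭ (setoid ℕ) (↭⇒↭ₛ (↭-sym bijective)) (AllPairs.map ℕ.<⇒≢ sorted)

length-words-bumps : ∀ m → All (λ π → length (words 0 0 π) ≡ ballot 0 (suc m) ∸ ballot 0 m)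
                               (bumps (applyUpTo suc (suc m)))
-- For size 1 the identity is the only candidate.
length-words-bumps zero    = []
length-words-bumps (suc m) =
  All.map lateDescent-count (bumps-lateDescent 1 2 _ (numbers-sorted (suc (suc m))))
  where
  ys = applyUpTo (λ i → suc (suc (suc i))) m
  lateDescent-count : ∀ {π} → LateDescent 0 (length ys) π →
    length (words 0 0 π) ≡ ballot 0 (suc (suc m)) ∸ ballot 0 (suc m)
  lateDescent-count {π} l = begin
    length (words 0 0 π)
      ≡⟨ ℕ.m+n∸n≡m _ (ballot 0 (suc (length ys))) ⟨
    length (words 0 0 π) ℕ.+ ballot 0 (suc (length ys)) ∸ ballot 0 (suc (length ys))
      ≡⟨ cong (_∸ ballot 0 (suc (length ys))) (length-words-lateDescent 0 l) ⟩
    ballot 0 (suc (suc (length ys))) ∸ ballot 0 (suc (length ys))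
      ≡⟨ cong (λ k → ballot 0 (suc (suc k)) ∸ ballot 0 (suc k)) (length-applyUpTo _ m) ⟩
    ballot 0 (suc (suc m)) ∸ ballot 0 (suc m) ∎

length-enumeration : ∀ m → length (enumeration (suc m)) ≡
  catalan (suc m) ℕ.+ m ℕ.* (catalan (suc m) ∸ catalan m)
length-enumeration m = begin
  length (enumeration n)
    ≡⟨ length-++ (words 0 0 xs) ⟩
  length (words 0 0 xs) ℕ.+ length (concatMap (words 0 0) (bumps xs))
    ≡⟨ cong₂ ℕ._+_ (length-words-sorted 0 xs (numbers-sorted n))
                   (length-concatMap-const (words 0 0) (length-words-bumps m)) ⟩
  ballot 0 (length xs) ℕ.+ length (bumps xs) ℕ.* (ballot 0 n ∸ ballot 0 m)
    ≡⟨ cong₂ (λ k l → ballot 0 k ℕ.+ l ℕ.* (ballot 0 n ∸ ballot 0 m))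
         (length-applyUpTo suc n)
         (trans (length-bumps 1 rest) (length-applyUpTo _ m)) ⟩
  ballot 0 n ℕ.+ m ℕ.* (ballot 0 n ∸ ballot 0 m)
    ≡⟨ cong₂ (λ b c → b ℕ.+ m ℕ.* (b ∸ c)) (ballot≡catalan n) (ballot≡catalan m) ⟩
  catalan n ℕ.+ m ℕ.* (catalan n ∸ catalan m) ∎
  where
  n = suc m
  xs = applyUpTo suc n
  rest = applyUpTo (λ i → suc (suc i)) m

catalan-mono : ∀ m → catalan m ≤ catalan (suc m)
catalan-mono m = subst₂ _≤_ (ballot≡catalan m) (ballot≡catalan (suc m)) (ballot-mono 0 m)

theorem16 : (n : ℕ) → n ≥ 1 →
    ∃[ k ] (pf n ⟨ [213] ∷ [312] ∷ [321] ∷ [] ⟩≐ k)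
    × (+ k ≡ + catalan n + (+ n - 1ℤ) * (+ catalan n - + catalan (n ∸ 1)))
    × (+ catalan n + (+ n - 1ℤ) * (+ catalan n - + catalan (n ∸ 1))
    ≡ + n * + catalan n - (+ n - 1ℤ) * + catalan (n ∸ 1))
theorem16 n@(suc m) _ =
    length (enumeration n)
  , (enumeration n , enumeration-unique n , ∈-enumeration n , refl)
  , (begin
      + length (enumeration n)
        ≡⟨ cong +_ (length-enumeration m) ⟩
      + (catalan n ℕ.+ m ℕ.* (catalan n ∸ catalan m))
        ≡⟨ ℤ.pos-+ (catalan n) _ ⟩
      + catalan n + + (m ℕ.* (catalan n ∸ catalan m))
        ≡⟨ cong (λ z → + catalan n + z) (ℤ.pos-* m _) ⟩
      + catalan n + + m * + (catalan n ∸ catalan m)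
        ≡⟨ cong (λ z → + catalan n + + m * z) difference ⟩
      -- `+ n - 1ℤ` computes to `+ m`, since `n` is `suc m`.
      + catalan n + (+ n - 1ℤ) * (+ catalan n - + catalan m) ∎)
  , rearrange (+ n) (+ catalan n) (+ catalan m)
  where
  difference : + (catalan n ∸ catalan m) ≡ + catalan n - + catalan m
  -- Monotonicity of the Catalan numbers rules out truncation.
  difference = sym (trans (ℤ.m-n≡m⊖n (catalan n) (catalan m)) (ℤ.⊖-≥ (catalan-mono m)))
  rearrange : ∀ i c d → c + (i - 1ℤ) * (c - d) ≡ i * c - (i - 1ℤ) * d
  rearrange = ℤ-Ring.solve-∀
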